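{- Let $n,k$ be positive integers. Suppose that $\mathcal{C}$ is a $3$-graph consisting of vertex-disjoint loose cycles $C_{n_1}, C_{n_2}, \ldots, C_{n_r}$ with $\sum_{i=1}^{r}n_i=n$, and that $k$ is the number of these loose cycles that have odd length. Then there exists a $3$-graph $\mathcal{H}$ with $n$ vertices and minimum codegree $\left\lfloor\frac{n+2k}{4}\right\rfloor-1$ that does not contain $\mathcal{C}$ as a spanning subhypergraph.
   Context: A $3$-graph (3-uniform hypergraph) $\mathcal{H}$ consists of a finite vertex set $V$ and an edge set $E\subseteq\binom{V}{3}$. Its minimum codegree is $\delta_2(\mathcal{H})=\min_{\{u,v\}\in\binom{V}{2}}|\{w\in V:\{u,v,w\}\in E\}|$. A loose cycle $C_t$ is a $3$-graph on $t$ vertices whose vertices can be ordered cyclically such that every hyperedge consists of three consecutive vertices and any two consecutive hyperedges share exactly one vertex. All loose cycles considered have $t\geq 6$ (and $t$ is necessarily even); equivalently, $C_t$ is obtained from a graph cycle with $t/2\ge 3$ edges by adding to each edge one new vertex, all new vertices being distinct. The length of $C_t$ is its number of hyperedges, i.e. $t/2$; so $C_{t}$ has odd length iff $t/2$ is odd. "$\mathcal{H}$ contains $\mathcal{C}$ as a spanning subhypergraph" means that $\mathcal{H}$ and $\mathcal{C}$ have the same number of vertices and there is an injective map $V(\mathcal{C})\to V(\mathcal{H})$ sending hyperedges to hyperedges. -}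

module Defs where

open import Level using (0ℓ)
open import Data.Nat using (ℕ; suc; _≤_; _/_)
open import Data.Nat.DivMod using (_mod_)
open import Data.Nat.Divisibility using (_∣_; _∣?_)
open import Data.Fin using (Fin; toℕ)
open import Data.Fin.Subset using (Subset; ⁅_⁆; _∪_; ∣_∣)
open import Data.Product using (∃; ∃-syntax; ∃₂; _×_)
open import Data.Vec using (Vec; lookup; tabulate)
open import Function.Bundles using (_⇔_)
open import Function.Definitions using (Injective)
open import Relation.Binary.PropositionalEquality using (_≡_; _≢_)
open import Relation.Nullary using (¬_; does; ¬?)
open import Relation.Unary using (Pred; Decidable)

-- The vertex set is Fin n.  Edges are a decidable set of vertex sets, so that
-- codegrees can be counted.
record 3-Graph (n : ℕ) : Set₁ where
  field
    Edge    : Pred (Subset n) 0ℓ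
    edge?   : Decidable Edge
    uniform : ∀ {e} → Edge e → ∣ e ∣ ≡ 3

open 3-Graph public

-- The set {x , y , z}; it has fewer than three elements, and so is never an
-- edge, when x, y, z are not pairwise distinct.
triple : ∀ {n} → Fin n → Fin n → Fin n → Subset n
triple x y z = ⁅ x ⁆ ∪ ⁅ y ⁆ ∪ ⁅ z ⁆

codegree : ∀ {n} → 3-Graph n → Fin n → Fin n → ℕ
codegree H u v = ∣ tabulate (λ w → does (edge? H (triple u v w))) ∣

-- d is the minimum of the codegrees over all pairs of distinct vertices
-- (a lower bound that is attained).  Never holds when there are no such pairs.
MinCodegree : ∀ {n} → 3-Graph n → ℕ → Set
MinCodegree H d =
  (∀ u v → u ≢ v → d ≤ codegree H u v) ×
  (∃₂ λ u v → u ≢ v × codegree H u v ≡ d)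

-- H contains C as a spanning subhypergraph.
IsSpanningSubhypergraph : ∀ {m n} → 3-Graph m → 3-Graph n → Set
IsSpanningSubhypergraph {m} {n} C H =
  m ≡ n ×
  (∃[ f ] Injective {A = Fin m} {B = Fin n} _≡_ _≡_ f ×
          (∀ x y z → Edge C (triple x y z) → Edge H (triple (f x) (f y) (f z))))

-- Cyclic successor.
next : ∀ {t} → Fin t → Fin t
next {suc t} i = suc (toℕ i) mod suc t

-- A loose cycle C_t whose vertices lie in Fin m, presented by a cyclic ordering
-- of its vertices.  The t/2 hyperedges are the triples of consecutive vertices
-- that start at an even position; as t is even, consecutive hyperedges share
-- exactly one vertex, the one at an even position, and the odd positions hold
-- the vertices added to the edges of the underlying graph cycle.
record LooseCycle (m t : ℕ) : Set where
  field
    even      : 2 ∣ t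
    t≥6       : 6 ≤ t
    order     : Fin t → Fin m
    injective : Injective _≡_ _≡_ order

  HasVertex : Fin m → Set
  HasVertex u = ∃[ j ] order j ≡ u

  HasEdge : Subset m → Set
  HasEdge e = ∃[ j ] 2 ∣ toℕ j ×
    e ≡ triple (order j) (order (next j)) (order (next (next j)))

open LooseCycle public

-- C is the union of vertex-disjoint loose cycles C_{n₁}, …, C_{nᵣ}.
record ConsistsOfLooseCycles {m r : ℕ} (C : 3-Graph m) (ns : Vec ℕ r) : Set where
  field
    cycle    : ∀ i → LooseCycle m (lookup ns i)
    disjoint : ∀ {i j u} → HasVertex (cycle i) u → HasVertex (cycle j) u → i ≡ j
    covering : ∀ u → ∃[ i ] HasVertex (cycle i) u
    edges    : ∀ e → Edge C e ⇔ (∃[ i ] HasEdge (cycle i) e)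

-- The length of C_t is its number of hyperedges, t / 2.
OddLength : ℕ → Set
OddLength t = ¬ (2 ∣ t / 2)

oddLength? : Decidable OddLength
oddLength? t = ¬? (2 ∣? t / 2)

{-# OPTIONS --safe #-}
-- Let A be a set of ⌊(n + 2k)/4⌋ − 1 vertices and let the edges of H be the
-- triples that meet A.  Two vertices outside A have exactly the vertices of A
-- as common neighbours, and every other pair has n − 2.  A spanning copy of the
-- union of loose cycles would make A a vertex cover of it.  In a loose cycle of
-- length q every vertex lies in at most two of the q hyperedges, so a cover
-- contains at least ⌈q / 2⌉ of its vertices; for C_t, four times this is
-- t, or t + 2 when the length is odd.  Summing over the cycles, a cover
-- has at least (n + 2k)/4 vertices.
module Submission where

open import Defs
open import Data.Nat using (ℕ; zero; suc; _+_; _*_; _∸_; _/_; _%_; _<_; _≤_; _<?_; z≤n; s≤s; NonZero)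
open import Data.Nat.Properties
open import Data.Nat.DivMod
  using (_mod_; m/n*n≤m; m/n*n≡m; m*n/n≡m; %-distribˡ-+; m%n%n≡m%n; n%n≡0; m<n⇒m%n≡m; m%n<n)
open import Data.Nat.Divisibility using (_∣_; divides; ∣-refl; ∣n⇒∣m*n)
open import Data.Nat.Tactic.RingSolver using (solve-∀)
open import Data.Fin as Fin using (Fin; toℕ; fromℕ<)
open import Data.Fin.Properties as Fin using (toℕ-fromℕ<; toℕ-injective)
open import Data.Fin.Subset
  using (Subset; inside; outside; _∈_; _∉_; _⊆_; _∪_; _-_; ⁅_⁆; ∁; ∣_∣)
open import Data.Fin.Subset.Properties
  using (_∈?_; x∈⁅x⁆; x∈⁅y⁆⇒x≡y; x∈p∪q⁻; x∈p∪q⁺; ∪-identityˡ; ∣⁅x⁆∣≡1; ∣∁p∣≡n∸∣p∣;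
         p⊆q⇒∣p∣≤∣q∣; x∈∁p⇒x∉p; x∈p∧x≢y⇒x∈p-y; x∈p⇒∣p-x∣<∣p∣)
open import Data.List as List using (List; []; _∷_; [_]; length; filter; applyDownFrom; concat)
open import Data.List.Properties using (length-++; length-map; filter-++; filter-accept)
import Data.List.Membership.Propositional as Mem
open import Data.List.Membership.Propositional.Properties
  using (∈-filter⁻; ∈-applyDownFrom⁻)
open import Data.List.Relation.Unary.All as All using (All; []; _∷_)
import Data.List.Relation.Unary.All.Properties as All
open import Data.List.Relation.Unary.AllPairs using ([]; _∷_)
import Data.List.Relation.Unary.AllPairs.Properties as AllPairs
open import Data.List.Relation.Unary.Unique.Propositional using (Unique)
import Data.List.Relation.Unary.Unique.Propositional.Properties as Unique
open import Data.Product using (∃; Σ-syntax; _×_; _,_; proj₁)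
open import Data.Sum using (_⊎_; inj₁; inj₂)
open import Data.Vec using (Vec; []; _∷_; sum; count; lookup; tabulate; here; there)
open import Data.Vec.Properties using (lookup∘tabulate; []=⇒lookup; lookup⇒[]=)
open import Function using (_∘_; Equivalence)
open import Relation.Binary.PropositionalEquality hiding ([_])
open import Relation.Nullary using (¬_; yes; no; does; contradiction; _×-dec_)
open import Relation.Nullary.Decidable using (dec-true)
open import Relation.Unary using (Pred; Decidable)

-- Subsets of `Fin n` and their sizes.

comprehension : ∀ {n p} {P : Pred (Fin n) p} → Decidable P → Subset n
comprehension P? = tabulate (does ∘ P?)

module _ {n p} {P : Pred (Fin n) p} (P? : Decidable P) where

  ∈-comprehension⁺ : ∀ {x} → P x → x ∈ comprehension P?
  ∈-comprehension⁺ {x} px =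
    lookup⇒[]= x _ (trans (lookup∘tabulate _ x) (dec-true (P? x) px))

  ∈-comprehension⁻ : ∀ {x} → x ∈ comprehension P? → P x
  ∈-comprehension⁻ {x} x∈ with P? x | trans (sym (lookup∘tabulate (does ∘ P?) x)) ([]=⇒lookup x∈)
  ... | yes px | _ = px
  ... | no _   | ()

below : ∀ {n} → ℕ → Subset n
below a = comprehension (λ w → toℕ w <? a)

-- Each case computes: `does` of `<?` is a Boolean test that strips a successor from both sides.
∣below∣ : ∀ {n a} → a ≤ n → ∣ below {n} a ∣ ≡ a
∣below∣ {zero}  z≤n       = refl
∣below∣ {suc n} z≤n       = ∣below∣ {n} z≤n
∣below∣ {suc n} (s≤s a≤n) = cong suc (∣below∣ a≤n)

∣⁅x⁆∪p∣ : ∀ {n} {x : Fin n} (p : Subset n) → x ∉ p → ∣ ⁅ x ⁆ ∪ p ∣ ≡ suc ∣ p ∣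
∣⁅x⁆∪p∣ {x = Fin.zero}  (inside  ∷ p) x∉p = contradiction here x∉p
∣⁅x⁆∪p∣ {x = Fin.zero}  (outside ∷ p) x∉p = cong (suc ∘ ∣_∣) (∪-identityˡ p)
∣⁅x⁆∪p∣ {x = Fin.suc x} (inside  ∷ p) x∉p = cong suc (∣⁅x⁆∪p∣ p (x∉p ∘ there))
∣⁅x⁆∪p∣ {x = Fin.suc x} (outside ∷ p) x∉p = ∣⁅x⁆∪p∣ p (x∉p ∘ there)

∈-pair⁻ : ∀ {n} {w x y : Fin n} → w ∈ ⁅ x ⁆ ∪ ⁅ y ⁆ → w ≡ x ⊎ w ≡ y
∈-pair⁻ w∈ with x∈p∪q⁻ _ _ w∈
... | inj₁ w∈x = inj₁ (x∈⁅y⁆⇒x≡y _ w∈x)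
... | inj₂ w∈y = inj₂ (x∈⁅y⁆⇒x≡y _ w∈y)

∣pair∣≡2 : ∀ {n} {x y : Fin n} → x ≢ y → ∣ ⁅ x ⁆ ∪ ⁅ y ⁆ ∣ ≡ 2
∣pair∣≡2 {y = y} x≢y = trans (∣⁅x⁆∪p∣ ⁅ y ⁆ (x≢y ∘ x∈⁅y⁆⇒x≡y _)) (cong suc (∣⁅x⁆∣≡1 y))

∣triple∣≡3 : ∀ {n} {x y z : Fin n} → x ≢ y → x ≢ z → y ≢ z → ∣ triple x y z ∣ ≡ 3
∣triple∣≡3 {x = x} {y} {z} x≢y x≢z y≢z =
  trans (∣⁅x⁆∪p∣ (⁅ y ⁆ ∪ ⁅ z ⁆) x∉) (cong suc (∣pair∣≡2 y≢z))
  where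
  x∉ : x ∉ ⁅ y ⁆ ∪ ⁅ z ⁆
  x∉ x∈ with ∈-pair⁻ x∈
  ... | inj₁ x≡y = x≢y x≡y
  ... | inj₂ x≡z = x≢z x≡z

module _ {n} {x y z : Fin n} where

  ∈-triple⁻ : ∀ {w} → w ∈ triple x y z → w ≡ x ⊎ w ≡ y ⊎ w ≡ z
  ∈-triple⁻ w∈ with x∈p∪q⁻ _ _ w∈
  ... | inj₁ w∈x  = inj₁ (x∈⁅y⁆⇒x≡y _ w∈x)
  ... | inj₂ w∈yz = inj₂ (∈-pair⁻ w∈yz)

  first∈triple : x ∈ triple x y z
  first∈triple = x∈p∪q⁺ (inj₁ (x∈⁅x⁆ x))

  second∈triple : y ∈ triple x y z
  second∈triple = x∈p∪q⁺ (inj₂ (x∈p∪q⁺ (inj₁ (x∈⁅x⁆ y))))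

  third∈triple : z ∈ triple x y z
  third∈triple = x∈p∪q⁺ (inj₂ (x∈p∪q⁺ (inj₂ (x∈⁅x⁆ z))))

-- Removing the head from `p` lowers its size and, by uniqueness, keeps the tail of the list inside.
length≤∣_∣ : ∀ {n} (p : Subset n) {xs : List (Fin n)} → Unique xs → All (_∈ p) xs → length xs ≤ ∣ p ∣
length≤∣ p ∣ []         []           = z≤n
length≤∣ p ∣ {x ∷ _} (x∉xs ∷ xs!) (x∈p ∷ xs⊆p) = ≤-<-trans
  (length≤∣ p - x ∣ xs! (All.zipWith (λ (x≢y , y∈p) → x∈p∧x≢y⇒x∈p-y y∈p (x≢y ∘ sym)) (x∉xs , xs⊆p)))
  (x∈p⇒∣p-x∣<∣p∣ x∈p)

-- The 3-graph of triples meeting `A`, and its codegrees.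

hitting : ∀ {n} → Subset n → 3-Graph n
hitting A = record
  { Edge    = λ e → ∣ e ∣ ≡ 3 × ∃ λ x → x ∈ e × x ∈ A
  ; edge?   = λ e → (∣ e ∣ ≟ 3) ×-dec Fin.any? (λ x → (x ∈? e) ×-dec (x ∈? A))
  ; uniform = proj₁
  }

module _ {n} (A : Subset n) where

  private
    neighbour? : ∀ u v → Decidable (λ w → Edge (hitting A) (triple u v w))
    neighbour? u v w = edge? (hitting A) (triple u v w)

  n∸2≤codegree-hitting : ∀ {u v} → u ≢ v → u ∈ A ⊎ v ∈ A → n ∸ 2 ≤ codegree (hitting A) u v
  n∸2≤codegree-hitting {u} {v} u≢v u∈A⊎v∈A = begin
    n ∸ 2                    ≡⟨ cong (n ∸_) (∣pair∣≡2 u≢v) ⟨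
    n ∸ ∣ ⁅ u ⁆ ∪ ⁅ v ⁆ ∣    ≡⟨ ∣∁p∣≡n∸∣p∣ (⁅ u ⁆ ∪ ⁅ v ⁆) ⟨
    -- `codegree` unfolds to the size of a comprehension, so an inclusion suffices: the pair already
    -- meets `A`, and any third vertex completes it to an edge.
    ∣ ∁ (⁅ u ⁆ ∪ ⁅ v ⁆) ∣    ≤⟨ p⊆q⇒∣p∣≤∣q∣ others⊆neighbours ⟩
    codegree (hitting A) u v ∎
    where
    open ≤-Reasoning
    hit : ∀ {w} → u ∈ A ⊎ v ∈ A → ∃ λ x → x ∈ triple u v w × x ∈ A
    hit (inj₁ u∈A) = u , first∈triple , u∈A
    hit {w} (inj₂ v∈A) = v , second∈triple {z = w} , v∈A
    others⊆neighbours : ∁ (⁅ u ⁆ ∪ ⁅ v ⁆) ⊆ comprehension (neighbour? u v)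
    others⊆neighbours {w} w∈ = ∈-comprehension⁺ (neighbour? u v)
      ( ∣triple∣≡3 u≢v
          (λ { refl → x∈∁p⇒x∉p w∈ (x∈p∪q⁺ (inj₁ (x∈⁅x⁆ w))) })
          (λ { refl → x∈∁p⇒x∉p w∈ (x∈p∪q⁺ (inj₂ (x∈⁅x⁆ w))) })
      , hit u∈A⊎v∈A )

  -- Only the third vertex can do the hitting. Conversely, a vertex of `A` differs from `u` and `v`,
  -- which lie outside, so the triple has size 3.
  codegree-hitting : ∀ {u v} → u ≢ v → u ∉ A → v ∉ A → codegree (hitting A) u v ≡ ∣ A ∣
  codegree-hitting {u} {v} u≢v u∉A v∉A =
    ≤-antisym (p⊆q⇒∣p∣≤∣q∣ neighbours⊆A) (p⊆q⇒∣p∣≤∣q∣ A⊆neighbours)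
    where
    neighbours⊆A : comprehension (neighbour? u v) ⊆ A
    neighbours⊆A w∈ with ∈-comprehension⁻ (neighbour? u v) w∈
    ... | _ , x , x∈uvw , x∈A with ∈-triple⁻ x∈uvw
    ...   | inj₁ refl        = contradiction x∈A u∉A
    ...   | inj₂ (inj₁ refl) = contradiction x∈A v∉A
    ...   | inj₂ (inj₂ refl) = x∈A
    A⊆neighbours : A ⊆ comprehension (neighbour? u v)
    A⊆neighbours {w} w∈A = ∈-comprehension⁺ (neighbour? u v)
      ( ∣triple∣≡3 u≢v (λ { refl → u∉A w∈A }) (λ { refl → v∉A w∈A })
      , w , third∈triple {x = u} {v} , w∈A )

  -- The pair `u`, `v` attains the minimum; `2 + ∣ A ∣ ≤ n` keeps pairs that meet `A` from falling
  -- below it.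
  minCodegree-hitting : ∀ {u v} → u ≢ v → u ∉ A → v ∉ A → 2 + ∣ A ∣ ≤ n →
                        MinCodegree (hitting A) ∣ A ∣
  minCodegree-hitting {u} {v} u≢v u∉A v∉A 2+∣A∣≤n =
    bound , u , v , u≢v , codegree-hitting u≢v u∉A v∉A
    where
    ∣A∣≤n∸2 : ∣ A ∣ ≤ n ∸ 2
    ∣A∣≤n∸2 = m+n≤o⇒m≤o∸n _ (≤-trans (≤-reflexive (+-comm ∣ A ∣ 2)) 2+∣A∣≤n)
    bound : ∀ x y → x ≢ y → ∣ A ∣ ≤ codegree (hitting A) x y
    bound x y x≢y with x ∈? A | y ∈? A
    ... | yes x∈A | _       = ≤-trans ∣A∣≤n∸2 (n∸2≤codegree-hitting x≢y (inj₁ x∈A))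
    ... | no _    | yes y∈A = ≤-trans ∣A∣≤n∸2 (n∸2≤codegree-hitting x≢y (inj₂ y∈A))
    ... | no x∉A  | no y∉A  = ≤-reflexive (sym (codegree-hitting x≢y x∉A y∉A))

minCodegree-hitting-below : ∀ {n a} → 2 + a ≤ n → MinCodegree (hitting (below {n} a)) a
minCodegree-hitting-below {n} {a} 2+a≤n =
  subst (MinCodegree (hitting A)) ∣A∣≡a
    (minCodegree-hitting A
      -- The two vertices outside `A` are numbered `a` and `a + 1`.
      (λ u≡v → 1+n≢n (sym (trans (sym (toℕ-fromℕ< 1+a≤n)) (trans (cong toℕ u≡v) (toℕ-fromℕ< 2+a≤n)))))
      (∉A ≤-refl 1+a≤n) (∉A (n≤1+n a) 2+a≤n)
      (subst (λ b → 2 + b ≤ n) (sym ∣A∣≡a) 2+a≤n))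
  where
  A : Subset n
  A = below a
  1+a≤n : suc a ≤ n
  1+a≤n = ≤-trans (n≤1+n _) 2+a≤n
  ∣A∣≡a : ∣ A ∣ ≡ a
  ∣A∣≡a = ∣below∣ (≤-trans (n≤1+n a) 1+a≤n)
  ∉A : ∀ {b} → a ≤ b → (b<n : b < n) → fromℕ< b<n ∉ A
  ∉A a≤b b<n b∈A = <⇒≱ (∈-comprehension⁻ (λ w → toℕ w <? a) b∈A)
    (≤-trans a≤b (≤-reflexive (sym (toℕ-fromℕ< b<n))))

-- Covers of a path of triples.

module _ {a p} {X : Set a} {P : Pred X p} (P? : Decidable P) (g : ℕ → X) where

  private
    hits : ℕ → ℕ
    hits t = length (filter P? (applyDownFrom g t))

    -- The indicator of `P (g i)`, written as a filtered singleton so that `filter-++` splits it off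
    -- from `hits`.
    weight : ℕ → ℕ
    weight i = length (filter P? [ g i ])

    weight≡1 : ∀ {i} → P (g i) → weight i ≡ 1
    weight≡1 pgi = cong length (filter-accept P? pgi)

    hits-suc : ∀ t → hits (suc t) ≡ weight t + hits t
    hits-suc t = trans (cong length (filter-++ P? [ g t ] _)) (length-++ (filter P? [ g t ]))

    hits-suc² : ∀ t → hits (suc (suc t)) ≡ weight (suc t) + (weight t + hits t)
    hits-suc² t = trans (hits-suc (suc t)) (cong (weight (suc t) +_) (hits-suc t))

    1≤weights : ∀ t → P (g t) ⊎ P (g (1 + t)) ⊎ P (g (2 + t)) →
                1 ≤ weight t + weight (1 + t) + weight (2 + t)
    1≤weights t (inj₁ h)        = ≤-trans (≤-reflexive (sym (weight≡1 h))) (≤-trans (m≤m+n _ _) (m≤m+n _ _))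
    1≤weights t (inj₂ (inj₁ h)) = ≤-trans (≤-reflexive (sym (weight≡1 h))) (≤-trans (m≤n+m _ (weight t)) (m≤m+n _ _))
    1≤weights t (inj₂ (inj₂ h)) = ≤-trans (≤-reflexive (sym (weight≡1 h))) (m≤n+m _ (weight t + weight (1 + t)))

    rearrange : ∀ h x y z → 2 * h + x + (x + y + z) + y ≡ 2 * (y + (x + h)) + z
    rearrange = solve-∀

    -- The first vertex of a path lies in one edge only, as does the last one,
    -- which is not among those that are counted; all others lie in at most two.
    path-cover : ∀ q → (∀ i → i < q → P (g (i * 2)) ⊎ P (g (1 + i * 2)) ⊎ P (g (2 + i * 2))) →
                 q + weight 0 ≤ 2 * hits (q * 2) + weight (q * 2)
    path-cover zero    _ = ≤-refl
    path-cover (suc q) covered = begin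
      suc q + w 0                                                     ≡⟨ +-comm 1 (q + w 0) ⟩
      q + w 0 + 1                                                     ≤⟨ +-mono-≤ (path-cover q (λ i i<q → covered i (m≤n⇒m≤1+n i<q)))
                                                                                     (1≤weights t (covered q ≤-refl)) ⟩
      -- The added vertex at the odd position `1 + t` lies in one edge only, yet `2 * hits` counts
      -- it twice; this slack pays for that.
      2 * hits t + w t + (w t + w (1 + t) + w (2 + t))                ≤⟨ m≤m+n _ _ ⟩
      2 * hits t + w t + (w t + w (1 + t) + w (2 + t)) + w (1 + t)    ≡⟨ rearrange (hits t) (w t) (w (1 + t)) (w (2 + t)) ⟩
      2 * (w (1 + t) + (w t + hits t)) + w (2 + t)                    ≡⟨ cong (λ h → 2 * h + w (2 + t)) (hits-suc² t) ⟨
      2 * hits (2 + t) + w (2 + t)                                    ∎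
      where
      open ≤-Reasoning
      t = q * 2
      w = weight

  -- When the path closes up, its two end weights are indicators of the same vertex and cancel.
  closed-path-cover : ∀ q → (∀ i → i < q → P (g (i * 2)) ⊎ P (g (1 + i * 2)) ⊎ P (g (2 + i * 2))) →
                      g (q * 2) ≡ g 0 → q ≤ 2 * length (filter P? (applyDownFrom g (q * 2)))
  closed-path-cover q covered closed = +-cancelʳ-≤ (weight 0) _ _
    (subst (λ x → q + weight 0 ≤ 2 * hits (q * 2) + length (filter P? [ x ])) closed (path-cover q covered))

-- A loose cycle as a closed path.

toℕ-mod : ∀ i t .{{_ : NonZero t}} → toℕ (i mod t) ≡ i % t
toℕ-mod i t = toℕ-fromℕ< (m%n<n i t)

next-mod : ∀ i t → next (i mod suc t) ≡ suc i mod suc t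
next-mod i t = toℕ-injective (begin
  toℕ (suc (toℕ (i mod suc t)) mod suc t)      ≡⟨ toℕ-mod (suc (toℕ (i mod suc t))) (suc t) ⟩
  suc (toℕ (i mod suc t)) % suc t              ≡⟨ cong (λ j → suc j % suc t) (toℕ-mod i (suc t)) ⟩
  (1 + i % suc t) % suc t                      ≡⟨ %-distribˡ-+ 1 (i % suc t) (suc t) ⟩
  (1 % suc t + i % suc t % suc t) % suc t      ≡⟨ cong (λ j → (1 % suc t + j) % suc t) (m%n%n≡m%n i (suc t)) ⟩
  (1 % suc t + i % suc t) % suc t              ≡⟨ %-distribˡ-+ 1 i (suc t) ⟨
  suc i % suc t                                ≡⟨ toℕ-mod (suc i) (suc t) ⟨
  toℕ (suc i mod suc t)                        ∎)
  where open ≡-Reasoning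

module _ {m t} (L : LooseCycle m (suc t)) where

  -- Unrolls the cyclic order into a periodic sequence on `ℕ`, the form that `closed-path-cover`
  -- takes; by `next-mod`, `next` becomes the successor.
  vertexAt : ℕ → Fin m
  vertexAt i = order L (i mod suc t)

  vertexAt-injective : ∀ {i j} → i < suc t → j < suc t → vertexAt i ≡ vertexAt j → i ≡ j
  vertexAt-injective {i} {j} i<t j<t eq = begin
    i                   ≡⟨ m<n⇒m%n≡m i<t ⟨
    i % suc t           ≡⟨ toℕ-mod i (suc t) ⟨
    toℕ (i mod suc t)   ≡⟨ cong toℕ (injective L eq) ⟩
    toℕ (j mod suc t)   ≡⟨ toℕ-mod j (suc t) ⟩
    j % suc t           ≡⟨ m<n⇒m%n≡m j<t ⟩
    j                   ∎
    where open ≡-Reasoning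

  vertexAt-closed : vertexAt (suc t) ≡ vertexAt 0
  vertexAt-closed = cong (order L) (toℕ-injective
    (trans (toℕ-mod (suc t) (suc t)) (n%n≡0 (suc t))))

  edgeAt : ∀ {i} → 2 ∣ i → i < suc t →
           HasEdge L (triple (vertexAt i) (vertexAt (1 + i)) (vertexAt (2 + i)))
  edgeAt {i} 2∣i i<t =
    i mod suc t ,
    subst (2 ∣_) (sym (trans (toℕ-mod i (suc t)) (m<n⇒m%n≡m i<t))) 2∣i ,
    cong₂ (λ j k → triple (vertexAt i) (order L j) (order L k)) (sym (next-mod i t))
      (trans (sym (next-mod (suc i) t)) (cong next (sym (next-mod i t))))

-- The list `[]` is a default for `t = zero`, which `t≥6` excludes; `vertexAt` is defined for a
-- successor only.
cycleHits : ∀ {m t p} {P : Pred (Fin m) p} → Decidable P → LooseCycle m t → List (Fin m)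
cycleHits {t = zero}  P? L = []
cycleHits {t = suc t} P? L = filter P? (applyDownFrom (vertexAt L) (suc t))

module _ {m p} {P : Pred (Fin m) p} (P? : Decidable P) where

  cycleHits-unique : ∀ {t} (L : LooseCycle m t) → Unique (cycleHits P? L)
  cycleHits-unique {zero}  L = []
  cycleHits-unique {suc t} L = Unique.filter⁺ P? (Unique.applyDownFrom⁺₁ (vertexAt L) (suc t)
    (λ j<i i<t eq → <⇒≢ j<i (sym (vertexAt-injective L i<t (<-trans j<i i<t) eq))))

  all-cycleHits : ∀ {t} (L : LooseCycle m t) → All P (cycleHits P? L)
  all-cycleHits {zero}  L = []
  all-cycleHits {suc t} L = All.all-filter P? (applyDownFrom (vertexAt L) (suc t))

  ∈-cycleHits⁻ : ∀ {t} (L : LooseCycle m t) {u} → u Mem.∈ cycleHits P? L → HasVertex L u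
  ∈-cycleHits⁻ {suc t} L u∈
    with ∈-applyDownFrom⁻ (vertexAt L) (proj₁ (∈-filter⁻ P? {xs = applyDownFrom (vertexAt L) (suc t)} u∈))
  ... | i , _ , u≡ = i mod suc t , sym u≡

  -- With `t = q * 2` the unrolled cycle is a closed path of `q` edges. The last edge ends at index
  -- `t`, which wraps around to 0.
  cycle-cover : ∀ {t} (L : LooseCycle m t) →
                (∀ {x y z} → HasEdge L (triple x y z) → P x ⊎ P y ⊎ P z) →
                t / 2 ≤ 2 * length (cycleHits P? L)
  cycle-cover {zero}  L covered = z≤n
  cycle-cover {suc t} L covered with even L
  ... | divides q t≡ = ≤-trans (≤-reflexive (trans (cong (_/ 2) t≡) (m*n/n≡m q 2)))
    (subst (λ s → q ≤ 2 * length (filter P? (applyDownFrom (vertexAt L) s))) (sym t≡)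
      (closed-path-cover P? (vertexAt L) q
        (λ i i<q → covered (edgeAt L (∣n⇒∣m*n i ∣-refl)
                     (<-≤-trans (*-monoˡ-< 2 i<q) (≤-reflexive (sym t≡)))))
        (trans (cong (vertexAt L) (sym t≡)) (vertexAt-closed L))))

-- Summing the cover bounds over the cycles.

module _ {p} {P : Pred ℕ p} (P? : Decidable P) where

  *count≤sum : ∀ c {r} (ns : Vec ℕ r) → (∀ i → c ≤ lookup ns i) → c * count P? ns ≤ sum ns
  *count≤sum c []       c≤ = ≤-reflexive (*-zeroʳ c)
  *count≤sum c (n ∷ ns) c≤ with P? n
  ... | yes _ = ≤-trans (≤-reflexive (*-suc c (count P? ns)))
                  (+-mono-≤ (c≤ Fin.zero) (*count≤sum c ns (c≤ ∘ Fin.suc)))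
  ... | no _  = m≤n⇒m≤o+n n (*count≤sum c ns (c≤ ∘ Fin.suc))

  -- Adds up the bounds for single cycles; with `c = 2` and `d = 4`, each odd cycle contributes its
  -- surplus of 2.
  sum+*count≤*length-concat :
    ∀ {a} {X : Set a} c d {r} (ns : Vec ℕ r) (xss : Fin r → List X) →
    (∀ i → lookup ns i ≤ d * length (xss i)) →
    (∀ i → P (lookup ns i) → lookup ns i + c ≤ d * length (xss i)) →
    sum ns + c * count P? ns ≤ d * length (concat (List.tabulate xss))
  sum+*count≤*length-concat c d []       xss bound boundP = ≤-trans (≤-reflexive (*-zeroʳ c)) z≤n
  sum+*count≤*length-concat c d (n ∷ ns) xss bound boundP
    with P? n | sum+*count≤*length-concat c d ns (xss ∘ Fin.suc) (bound ∘ Fin.suc) (boundP ∘ Fin.suc)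
  ... | yes pn | rest = begin
    n + sum ns + c * suc (count P? ns)     ≡⟨ regroup n (sum ns) c (count P? ns) ⟩
    n + c + (sum ns + c * count P? ns)     ≤⟨ +-mono-≤ (boundP Fin.zero pn) rest ⟩
    d * length xs + d * length xs′         ≡⟨ *-distribˡ-+ d (length xs) (length xs′) ⟨
    d * (length xs + length xs′)           ≡⟨ cong (d *_) (length-++ xs) ⟨
    d * length (xs List.++ xs′)            ∎
    where
    open ≤-Reasoning
    xs  = xss Fin.zero
    xs′ = concat (List.tabulate (xss ∘ Fin.suc))
    regroup : ∀ n s c k → n + s + c * suc k ≡ n + c + (s + c * k)
    regroup = solve-∀
  ... | no _   | rest = begin
    n + sum ns + c * count P? ns           ≡⟨ +-assoc n (sum ns) _ ⟩
    n + (sum ns + c * count P? ns)         ≤⟨ +-mono-≤ (bound Fin.zero) rest ⟩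
    d * length xs + d * length xs′         ≡⟨ *-distribˡ-+ d (length xs) (length xs′) ⟨
    d * (length xs + length xs′)           ≡⟨ cong (d *_) (length-++ xs) ⟨
    d * length (xs List.++ xs′)            ∎
    where
    open ≤-Reasoning
    xs  = xss Fin.zero
    xs′ = concat (List.tabulate (xss ∘ Fin.suc))

module _ {t} h (2∣t : 2 ∣ t) (t/2≤2h : t / 2 ≤ 2 * h) where

  private
    double : ∀ h → 2 * h * 2 ≡ 4 * h
    double = solve-∀

  even⇒≤4* : t ≤ 4 * h
  even⇒≤4* = begin
    t           ≡⟨ m/n*n≡m 2∣t ⟨
    t / 2 * 2   ≤⟨ *-monoˡ-≤ 2 t/2≤2h ⟩
    2 * h * 2   ≡⟨ double h ⟩
    4 * h       ∎
    where
    open ≤-Reasoning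

  -- An odd `t / 2` cannot equal the even number `2 * h`, so the inequality is strict, and doubling
  -- turns the gain of 1 into 2.
  odd⇒+2≤4* : OddLength t → t + 2 ≤ 4 * h
  odd⇒+2≤4* odd = begin
    t + 2             ≡⟨ cong (_+ 2) (m/n*n≡m 2∣t) ⟨
    t / 2 * 2 + 2     ≡⟨ +-comm (t / 2 * 2) 2 ⟩
    suc (t / 2) * 2   ≤⟨ *-monoˡ-≤ 2 t/2<2h ⟩
    2 * h * 2         ≡⟨ double h ⟩
    4 * h             ∎
    where
    open ≤-Reasoning
    t/2<2h : t / 2 < 2 * h
    t/2<2h = ≤∧≢⇒< t/2≤2h (λ eq → odd (divides h (trans eq (*-comm 2 h))))

-- The cover comes as a list without repetitions, so that it can be carried along an injection.
-- Disjointness of the cycles makes the concatenation repetition-free.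
vertex-cover-bound :
  ∀ {m r p} {C : 3-Graph m} {ns : Vec ℕ r} → ConsistsOfLooseCycles C ns →
  {P : Pred (Fin m) p} → Decidable P → (∀ {x y z} → Edge C (triple x y z) → P x ⊎ P y ⊎ P z) →
  ∃ λ us → Unique us × All P us × sum ns + 2 * count oddLength? ns ≤ 4 * length us
vertex-cover-bound {ns = ns} D {P} P? covered =
  concat (List.tabulate hits) ,
  Unique.concat⁺ (All.tabulate⁺ (λ i → cycleHits-unique P? (cycle i)))
    (AllPairs.tabulate⁺ (λ {i} {j} i≢j (u∈i , u∈j) →
      i≢j (disjoint (∈-cycleHits⁻ P? (cycle i) u∈i) (∈-cycleHits⁻ P? (cycle j) u∈j)))) ,
  All.concat⁺ (All.tabulate⁺ (λ i → all-cycleHits P? (cycle i))) ,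
  sum+*count≤*length-concat oddLength? 2 4 ns hits
    (λ i → even⇒≤4* (length (hits i)) (even (cycle i)) (bound i))
    (λ i → odd⇒+2≤4* (length (hits i)) (even (cycle i)) (bound i))
  where
  open ConsistsOfLooseCycles D
  hits : ∀ i → List _
  hits i = cycleHits P? (cycle i)
  bound : ∀ i → lookup ns i / 2 ≤ 2 * length (hits i)
  bound i = cycle-cover P? (cycle i) (λ e → covered (Equivalence.from (edges _) (i , e)))

-- The preimage of `A` under the embedding covers `C`, since every edge of `C` is sent to a triple
-- meeting `A`; injectivity keeps its size at most `∣ A ∣`.
spanning⇒≤4* :
  ∀ {m n r} {C : 3-Graph m} {ns : Vec ℕ r} → ConsistsOfLooseCycles C ns → (A : Subset n) →
  IsSpanningSubhypergraph C (hitting A) → sum ns + 2 * count oddLength? ns ≤ 4 * ∣ A ∣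
spanning⇒≤4* {C = C} D A (_ , f , f-injective , f-hom)
  with vertex-cover-bound D {λ u → f u ∈ A} (λ u → f u ∈? A) covered
  where
  covered : ∀ {x y z} → Edge C (triple x y z) → f x ∈ A ⊎ f y ∈ A ⊎ f z ∈ A
  covered {x} {y} {z} e with f-hom x y z e
  ... | _ , w , w∈ , w∈A with ∈-triple⁻ w∈
  ...   | inj₁ refl        = inj₁ w∈A
  ...   | inj₂ (inj₁ refl) = inj₂ (inj₁ w∈A)
  ...   | inj₂ (inj₂ refl) = inj₂ (inj₂ w∈A)
... | us , us! , fus⊆A , bound = ≤-trans bound (*-monoʳ-≤ 4 (begin
  length us                ≡⟨ length-map f us ⟨
  length (List.map f us)   ≤⟨ length≤∣ A ∣ (Unique.map⁺ f-injective us!) (All.map⁺ fus⊆A) ⟩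
  ∣ A ∣                    ∎))
  where open ≤-Reasoning

-- Arithmetic of the bound, and the conclusion.

4*[m/4∸1]<m : ∀ {m} → 0 < m → 4 * (m / 4 ∸ 1) < m
4*[m/4∸1]<m {m} 0<m with m / 4 | m/n*n≤m m 4
-- For `m < 4` the truncated subtraction gives 0, and positivity of `m` decides.
... | zero  | _   = 0<m
... | suc a | ≤m = ≤-trans (m≤n+m (suc (4 * a)) 3) (≤-trans (≤-reflexive (expand a)) ≤m)
  where
  expand : ∀ a → 3 + suc (4 * a) ≡ suc a * 4
  expand = solve-∀

-- Leaves room for two vertices outside `A`. After multiplying by 4, it is enough that
-- `8 + 2 * k ≤ 3 * n`.
2+[n+2k]/4∸1≤n : ∀ {n k} → 0 < k → 6 * k ≤ n → 2 + ((n + 2 * k) / 4 ∸ 1) ≤ n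
2+[n+2k]/4∸1≤n {n} {k} 0<k 6k≤n = *-cancelʳ-≤ _ _ 4 (begin
  (2 + ((n + 2 * k) / 4 ∸ 1)) * 4    ≤⟨ *-monoˡ-≤ 4 (+-monoʳ-≤ 2 (m∸n≤m ((n + 2 * k) / 4) 1)) ⟩
  8 + (n + 2 * k) / 4 * 4            ≤⟨ +-monoʳ-≤ 8 (m/n*n≤m (n + 2 * k) 4) ⟩
  8 * 1 + (n + 2 * k)                ≤⟨ +-monoˡ-≤ _ (*-monoʳ-≤ 8 0<k) ⟩
  -- Pads `10 * k` to `18 * k`, a multiple of `6 * k`.
  8 * k + (n + 2 * k)                ≤⟨ m≤m+n _ (8 * k) ⟩
  8 * k + (n + 2 * k) + 8 * k        ≡⟨ collect n k ⟩
  n + 3 * (6 * k)                    ≤⟨ +-monoʳ-≤ n (*-monoʳ-≤ 3 6k≤n) ⟩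
  n + 3 * n                          ≡⟨ *-comm 4 n ⟩
  n * 4                              ∎)
  where
  open ≤-Reasoning
  collect : ∀ n k → 8 * k + (n + 2 * k) + 8 * k ≡ n + 3 * (6 * k)
  collect = solve-∀

proposition1p5 : (n k : ℕ) → 0 < n → 0 < k →
    (m r : ℕ) (C : 3-Graph m) (ns : Vec ℕ r) →
    ConsistsOfLooseCycles C ns →
    sum ns ≡ n →
    count oddLength? ns ≡ k →
    Σ[ H ∈ 3-Graph n ] (MinCodegree H ((n + 2 * k) / 4 ∸ 1) × ¬ IsSpanningSubhypergraph C H)
proposition1p5 n k 0<n 0<k m r C ns D refl refl =
  hitting (below a) , minCodegree-hitting-below 2+a≤n , λ spanning →
    -- A spanning copy would give `n + 2 * k ≤ 4 * a`, but rounding down and subtracting 1 makes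
    -- `4 * a` smaller than `n + 2 * k`.
    <⇒≱ (4*[m/4∸1]<m (m≤n⇒m≤n+o _ 0<n))
      (subst (λ b → n + 2 * k ≤ 4 * b) (∣below∣ (m+n≤o⇒n≤o 2 2+a≤n)) (spanning⇒≤4* D (below a) spanning))
  where
  a : ℕ
  a = (n + 2 * k) / 4 ∸ 1
  2+a≤n : 2 + a ≤ n
  -- Each of the `k` odd cycles has at least 6 vertices, so `6 * k ≤ n`.
  2+a≤n = 2+[n+2k]/4∸1≤n 0<k
    (*count≤sum oddLength? 6 ns (λ i → t≥6 (ConsistsOfLooseCycles.cycle D i)))
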